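{- Let $\varphi$ be a GFG-QPTL formula and $\mathcal X_1,\mathcal X_2\in\mathrm{HAsg}_\supseteq(\mathrm{free}(\varphi))$ with $\mathcal X_1\sqsubseteq\mathcal X_2$. Then $\mathcal X_1\models^{\exists\forall}\varphi$ implies $\mathcal X_2\models^{\exists\forall}\varphi$, and $\mathcal X_2\models^{\forall\exists}\varphi$ implies $\mathcal X_1\models^{\forall\exists}\varphi$.
   Context: Let $AP$ be a set of atomic propositions and $\mathbb B=\{\top,\bot\}$. A temporal valuation is a function $f:\mathbb N\to\mathbb B$. An assignment is a partial function $\chi:AP\rightharpoonup(\mathbb N\to\mathbb B)$; $\mathrm{Asg}$ is the set of all assignments, $\mathrm{Asg}(P)$ the set of assignments with domain exactly $P\subseteq AP$. For an assignment $\chi$, $p\in AP$ and a temporal valuation $f$, $\chi[p\mapsto f]$ is the assignment that agrees with $\chi$ except that it maps $p$ to $f$. A hyperassignment is a set $\mathcal X$ with $\emptyset\neq\mathcal X\subseteq 2^{\mathrm{Asg}(P)}$ and $\emptyset\notin\mathcal X$, for some $P\subseteq AP$; this $P$ is denoted $\mathrm{ap}(\mathcal X)$. $\mathrm{HAsg}$ is the set of all hyperassignments, $\mathrm{HAsg}(P)$ those with $\mathrm{ap}(\mathcal X)=P$, and $\mathrm{HAsg}_\supseteq(P)$ those with $\mathrm{ap}(\mathcal X)\supseteq P$. For $\mathcal X_1,\mathcal X_2\in\mathrm{HAsg}$, $\mathcal X_1\sqsubseteq\mathcal X_2$ iff for every $X_1\in\mathcal X_1$ there is $X_2\in\mathcal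 X_2$ with $X_2\subseteq X_1$. A choice function for $\mathcal X$ is a map $c:\mathcal X\to\mathrm{Asg}$ with $c(X)\in X$ for all $X\in\mathcal X$. The dual of $\mathcal X$ is $\overline{\mathcal X}=\{\mathrm{img}(c): c\text{ a choice function for }\mathcal X\}$. $\mathrm{par}(\mathcal X)$ is the set of pairs $(\mathcal X_1,\mathcal X_2)$ of (possibly empty) subsets of $\mathcal X$ with $\mathcal X_1\cap\mathcal X_2=\emptyset$ and $\mathcal X_1\cup\mathcal X_2=\mathcal X$. A functor over $P\subseteq AP$ is a function $F:\mathrm{Asg}(P)\to(\mathbb N\to\mathbb B)$; $\mathrm{Fnc}(P)$ is the set of all of them. $\mathrm{ext}(\chi,F,p)=\chi[p\mapsto F(\chi)]$ and $\mathrm{ext}(X,F,p)=\{\mathrm{ext}(\chi,F,p):\chi\in X\}$. For $\chi_1,\chi_2\in\mathrm{Asg}(P)$, $p\in P$, $k\in\mathbb N$: $\chi_1\approx^{>k}_p\chi_2$ iff $\chi_1(q)=\chi_2(q)$ for all $q\in P\setminus\{p\}$ and $\chi_1(p)(t)=\chi_2(p)(t)$ for all $t\le k$; $\chi_1\approx^{\ge k}_p\chi_2$ is defined the same way with $t<k$ in place of $t\le k$. $F\in\mathrm{Fnc}(P)$ is behavioral (resp. strongly behavioral) w.r.t. $p\in P$ if $F(\chi_1)(k)=F(\chi_2)(k)$ for all $k\in\mathbb N$ and all $\chi_1,\chi_2$ with $\chi_1\approx^{>k}_p\chi_2$ (resp. $\chi_1\approx^{\ge k}_p\chi_2$). A quantifier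 specification is a pair $\sigma=\langle P_B,P_S\rangle$ of subsets of $AP$; $\mathrm{Fnc}_\sigma(P)$ is the set of $F\in\mathrm{Fnc}(P)$ that are behavioral w.r.t. every $p\in P_B\cap P$ and strongly behavioral w.r.t. every $p\in P_S\cap P$. $\mathrm{ext}_\sigma(\mathcal X,p)=\{\mathrm{ext}(X,F,p):X\in\mathcal X,\ F\in\mathrm{Fnc}_\sigma(\mathrm{ap}(\mathcal X))\}$. GFG-QPTL formulas are generated by $\varphi::=\psi\mid\neg\varphi\mid\varphi\wedge\varphi\mid\varphi\vee\varphi\mid\exists p{:}\sigma.\varphi\mid\forall p{:}\sigma.\varphi$, where $\psi$ is an LTL formula over $AP$, $p\in AP$ and $\sigma$ a quantifier specification; we also write $\exists^\sigma p.\varphi$, $\forall^\sigma p.\varphi$. QPTL formulas are those in which every specification is $\langle\emptyset,\emptyset\rangle$. $\mathrm{free}(\varphi)$ is the set of free propositions. $\chi\models_{LTL}\psi$ iff the infinite word whose $t$-th letter is the valuation $q\mapsto\chi(q)(t)$ satisfies $\psi$ in the standard LTL sense. Alternation flags are $\exists\forall$ and $\forall\exists$; $\bar\alpha$ is the flag different from $\alpha$. For a GFG-QPTL formula $\varphi$, $\mathcal X\in\mathrm{HAsg}_\supseteq(\mathrm{free}(\varphi))$ and flag $\alpha$, $\mathcal X\models^\alpha\varphi$ is defined inductively: (1) for LTL $\psi$: $\mathcal X\models^{\exists\forall}\psi$ iff there is $X\in\mathcal X$ with $\chi\models_{LTL}\psi$ for all $\chi\in X$; $\mathcal X\models^{\forall\exists}\psi$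 iff for every $X\in\mathcal X$ there is $\chi\in X$ with $\chi\models_{LTL}\psi$; (2) $\mathcal X\models^\alpha\neg\phi$ iff not $\mathcal X\models^{\bar\alpha}\phi$; (3) $\mathcal X\models^{\exists\forall}\phi_1\wedge\phi_2$ iff for every $(\mathcal X_1,\mathcal X_2)\in\mathrm{par}(\mathcal X)$, either ($\mathcal X_1\ne\emptyset$ and $\mathcal X_1\models^{\exists\forall}\phi_1$) or ($\mathcal X_2\ne\emptyset$ and $\mathcal X_2\models^{\exists\forall}\phi_2$); $\mathcal X\models^{\forall\exists}\phi_1\wedge\phi_2$ iff $\overline{\mathcal X}\models^{\exists\forall}\phi_1\wedge\phi_2$; (4) $\mathcal X\models^{\forall\exists}\phi_1\vee\phi_2$ iff there is $(\mathcal X_1,\mathcal X_2)\in\mathrm{par}(\mathcal X)$ such that ($\mathcal X_1\neq\emptyset$ implies $\mathcal X_1\models^{\forall\exists}\phi_1$) and ($\mathcal X_2\neq\emptyset$ implies $\mathcal X_2\models^{\forall\exists}\phi_2$); $\mathcal X\models^{\exists\forall}\phi_1\vee\phi_2$ iff $\overline{\mathcal X}\models^{\forall\exists}\phi_1\vee\phi_2$; (5) $\mathcal X\models^{\exists\forall}\exists p{:}\sigma.\phi$ iff $\mathrm{ext}_\sigma(\mathcal X,p)\models^{\exists\forall}\phi$; $\mathcal X\models^{\forall\exists}\exists p{:}\sigma.\phi$ iff $\overline{\mathcal X}\models^{\exists\forall}\exists p{:}\sigma.\phi$; (6) $\mathcal X\models^{\forall\exists}\forall p{:}\sigma.\phi$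 iff $\mathrm{ext}_\sigma(\mathcal X,p)\models^{\forall\exists}\phi$; $\mathcal X\models^{\exists\forall}\forall p{:}\sigma.\phi$ iff $\overline{\mathcal X}\models^{\forall\exists}\forall p{:}\sigma.\phi$. -}

module Defs where

open import Level using (0ℓ; Lift) renaming (suc to lsuc)
open import Data.Bool using (Bool; true; false; T)
open import Data.Maybe using (Maybe; just; nothing; Is-just; fromMaybe)
  renaming (map to mapMaybe)
open import Data.Nat using (ℕ; suc; _≤_; _<_)
open import Data.Product using (Σ-syntax; ∃-syntax; _×_; _,_; proj₁; proj₂)
open import Data.Refinement using (Refinement-syntax; value)
open import Data.Sum using (_⊎_)
open import Data.Unit using (⊤)
open import Relation.Nullary using (¬_; yes; no)
open import Relation.Unary
  using (Pred; _∈_; _⊆_; _≐_; _∪_; _∩_; _∖_; ∅; ｛_｝; Satisfiable)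
open import Relation.Binary.Definitions using (DecidableEquality)
open import Relation.Binary.PropositionalEquality using (_≡_; _≢_)

-- The elements of a subset, as a type; the membership proof is irrelevant, so
-- that functions on ⟨ P ⟩ depend on the element only.
⟨_⟩ : {A : Set} → Pred A 0ℓ → Set
⟨_⟩ {A} P = [ x ∈ A ∣ x ∈ P ]

TemporalValuation : Set
TemporalValuation = ℕ → Bool

data Flag : Set where
  ∃∀ ∀∃ : Flag

dualFlag : Flag → Flag
dualFlag ∃∀ = ∀∃
dualFlag ∀∃ = ∃∀

module GFG-QPTL (AP : Set) (_≟_ : DecidableEquality AP) where

  Asg : Set
  Asg = AP → Maybe TemporalValuation

  dom : Asg → Pred AP 0ℓ
  dom χ q = Is-just (χ q)

  Asg[_] : Pred AP 0ℓ → Pred Asg 0ℓ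
  Asg[ P ] χ = dom χ ≐ P

  _[_↦_] : Asg → AP → TemporalValuation → Asg
  (χ [ p ↦ f ]) q with q ≟ p
  ... | yes _ = just f
  ... | no  _ = χ q

  -- χ(q)(t), undefined when χ(q) is.
  at : Asg → AP → ℕ → Maybe Bool
  at χ q t = mapMaybe (λ f → f t) (χ q)

  -- Sets of assignments are characteristic functions.  This makes 2^Asg a small
  -- type, so that dualisation and extension do not raise the universe level.
  2^Asg : Set
  2^Asg = Asg → Bool

  ⟦_⟧ : 2^Asg → Pred Asg 0ℓ
  ⟦ X ⟧ χ = T (X χ)

  Family : Set₁
  Family = Pred 2^Asg 0ℓ

  record HAsg[_] (P : Pred AP 0ℓ) (𝒳 : Family) : Set where
    field
      nonempty : Satisfiable 𝒳
      ∅∉       : ∀ {X} → X ∈ 𝒳 → Satisfiable ⟦ X ⟧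
      over     : ∀ {X} → X ∈ 𝒳 → ⟦ X ⟧ ⊆ Asg[ P ]

  HAsg : Family → Set₁
  HAsg 𝒳 = ∃[ P ] HAsg[ P ] 𝒳

  -- Defined for every family; on hyperassignments it is the unique P with
  -- 𝒳 ∈ HAsg(P), see ap-unique.
  ap : Family → Pred AP 0ℓ
  ap 𝒳 q = Σ[ X ∈ 2^Asg ] X ∈ 𝒳 × (Σ[ χ ∈ Asg ] χ ∈ ⟦ X ⟧ × q ∈ dom χ)

  ap-unique : ∀ {P 𝒳} → HAsg[ P ] 𝒳 → ap 𝒳 ≐ P
  ap-unique h = (λ (X , X∈𝒳 , χ , χ∈X , q∈χ) → proj₁ (over X∈𝒳 χ∈X) q∈χ)
              , (λ q∈P → let (X , X∈𝒳) = nonempty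
                             (χ , χ∈X) = ∅∉ X∈𝒳
                         in X , X∈𝒳 , χ , χ∈X , proj₂ (over X∈𝒳 χ∈X) q∈P)
    where open HAsg[_] h

  HAsg⊇[_] : Pred AP 0ℓ → Family → Set₁
  HAsg⊇[ P ] 𝒳 = HAsg 𝒳 × P ⊆ ap 𝒳

  infix 4 _⊑_
  _⊑_ : Family → Family → Set
  𝒳₁ ⊑ 𝒳₂ = ∀ {X₁} → X₁ ∈ 𝒳₁ → Σ[ X₂ ∈ 2^Asg ] X₂ ∈ 𝒳₂ × ⟦ X₂ ⟧ ⊆ ⟦ X₁ ⟧

  IsChoiceFunction : (𝒳 : Family) → (⟨ 𝒳 ⟩ → Asg) → Set
  IsChoiceFunction 𝒳 c = ∀ X → c X ∈ ⟦ value X ⟧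

  img : {𝒳 : Family} → (⟨ 𝒳 ⟩ → Asg) → Pred Asg 0ℓ
  img c χ = ∃[ X ] c X ≡ χ

  dual : Family → Family
  dual 𝒳 Y = Σ[ c ∈ (⟨ 𝒳 ⟩ → Asg) ] IsChoiceFunction 𝒳 c × ⟦ Y ⟧ ≐ img c

  par : Family → Family → Family → Set
  par 𝒳 𝒳₁ 𝒳₂ = (𝒳₁ ∩ 𝒳₂ ≐ ∅) × (𝒳₁ ∪ 𝒳₂ ≐ 𝒳)

  Fnc : Pred AP 0ℓ → Set
  Fnc P = ⟨ Asg[ P ] ⟩ → TemporalValuation

  agreeOff : (P : Pred AP 0ℓ) (p : AP) → (χ₁ χ₂ : ⟨ Asg[ P ] ⟩) → Set
  agreeOff P p χ₁ χ₂ = ∀ {q} → q ∈ P → q ≢ p → value χ₁ q ≡ value χ₂ q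

  ≈[>_] : ℕ → (P : Pred AP 0ℓ) (p : AP) → (χ₁ χ₂ : ⟨ Asg[ P ] ⟩) → Set
  ≈[> k ] P p χ₁ χ₂ =
    agreeOff P p χ₁ χ₂ × (∀ {t} → t ≤ k → at (value χ₁) p t ≡ at (value χ₂) p t)

  ≈[≥_] : ℕ → (P : Pred AP 0ℓ) (p : AP) → (χ₁ χ₂ : ⟨ Asg[ P ] ⟩) → Set
  ≈[≥ k ] P p χ₁ χ₂ =
    agreeOff P p χ₁ χ₂ × (∀ {t} → t < k → at (value χ₁) p t ≡ at (value χ₂) p t)

  Behavioral : (P : Pred AP 0ℓ) → AP → Fnc P → Set
  Behavioral P p F = ∀ k χ₁ χ₂ → ≈[> k ] P p χ₁ χ₂ → F χ₁ k ≡ F χ₂ k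

  StronglyBehavioral : (P : Pred AP 0ℓ) → AP → Fnc P → Set
  StronglyBehavioral P p F = ∀ k χ₁ χ₂ → ≈[≥ k ] P p χ₁ χ₂ → F χ₁ k ≡ F χ₂ k

  record Spec : Set₁ where
    constructor ⟪_,_⟫
    field
      P-B P-S : Pred AP 0ℓ
  open Spec public

  Fnc[_] : Spec → (P : Pred AP 0ℓ) → Pred (Fnc P) 0ℓ
  Fnc[ σ ] P F = (∀ {p} → p ∈ P-B σ ∩ P → Behavioral P p F)
               × (∀ {p} → p ∈ P-S σ ∩ P → StronglyBehavioral P p F)

  extAsg : {P : Pred AP 0ℓ} → ⟨ Asg[ P ] ⟩ → Fnc P → AP → Asg
  extAsg χ F p = value χ [ p ↦ F χ ]

  extSet : {P : Pred AP 0ℓ} → 2^Asg → Fnc P → AP → Pred Asg 0ℓ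
  extSet {P} X F p χ′ =
    Σ[ χ ∈ ⟨ Asg[ P ] ⟩ ] value χ ∈ ⟦ X ⟧ × extAsg χ F p ≡ χ′

  ext : Spec → Family → AP → Family
  ext σ 𝒳 p Y = Σ[ X ∈ 2^Asg ] X ∈ 𝒳
    × (Σ[ F ∈ Fnc (ap 𝒳) ] F ∈ Fnc[ σ ] (ap 𝒳) × ⟦ Y ⟧ ≐ extSet X F p)

  data LTL : Set where
    tt      : LTL
    atom    : AP → LTL
    neg     : LTL → LTL
    and or  : LTL → LTL → LTL
    next    : LTL → LTL
    until   : LTL → LTL → LTL

  freeLTL : LTL → Pred AP 0ℓ
  freeLTL tt            = ∅
  freeLTL (atom q)      = ｛ q ｝
  freeLTL (neg ψ)       = freeLTL ψ
  freeLTL (and ψ₁ ψ₂)   = freeLTL ψ₁ ∪ freeLTL ψ₂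
  freeLTL (or ψ₁ ψ₂)    = freeLTL ψ₁ ∪ freeLTL ψ₂
  freeLTL (next ψ)      = freeLTL ψ
  freeLTL (until ψ₁ ψ₂) = freeLTL ψ₁ ∪ freeLTL ψ₂

  Word : Set
  Word = ℕ → AP → Bool

  _∣_⊨_ : Word → ℕ → LTL → Set
  w ∣ i ⊨ tt          = ⊤
  w ∣ i ⊨ atom q      = T (w i q)
  w ∣ i ⊨ neg ψ       = ¬ (w ∣ i ⊨ ψ)
  w ∣ i ⊨ and ψ₁ ψ₂   = (w ∣ i ⊨ ψ₁) × (w ∣ i ⊨ ψ₂)
  w ∣ i ⊨ or ψ₁ ψ₂    = (w ∣ i ⊨ ψ₁) ⊎ (w ∣ i ⊨ ψ₂)
  w ∣ i ⊨ next ψ      = w ∣ suc i ⊨ ψ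
  w ∣ i ⊨ until ψ₁ ψ₂ = Σ[ j ∈ ℕ ] i ≤ j × (w ∣ j ⊨ ψ₂)
                         × (∀ k → i ≤ k → k < j → w ∣ k ⊨ ψ₁)

  -- The letters are totalised by false outside dom χ; this value is never
  -- consulted when evaluating ψ with freeLTL ψ ⊆ dom χ.
  word : Asg → Word
  word χ t q = fromMaybe false (at χ q t)

  _⊨LTL_ : Asg → LTL → Set
  χ ⊨LTL ψ = word χ ∣ 0 ⊨ ψ

  infixr 7 _∧′_
  infixr 6 _∨′_

  data Formula : Set₁ where
    ltl       : LTL → Formula
    ¬′_       : Formula → Formula
    _∧′_ _∨′_ : Formula → Formula → Formula
    ∃′ ∀′     : AP → Spec → Formula → Formula

  free : Formula → Pred AP 0ℓ
  free (ltl ψ)    = freeLTL ψ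
  free (¬′ φ)     = free φ
  free (φ₁ ∧′ φ₂) = free φ₁ ∪ free φ₂
  free (φ₁ ∨′ φ₂) = free φ₁ ∪ free φ₂
  free (∃′ p σ φ) = free φ ∖ ｛ p ｝
  free (∀′ p σ φ) = free φ ∖ ｛ p ｝

  -- The ∃∀ clause of conjunction and the ∀∃ clause of disjunction, given the
  -- semantics of the two subformulas under the same flag.
  Conj Disj : (S₁ S₂ : Family → Set₁) → Family → Set₁
  Conj S₁ S₂ 𝒳 = ∀ 𝒳₁ 𝒳₂ → par 𝒳 𝒳₁ 𝒳₂ →
    (Satisfiable 𝒳₁ × S₁ 𝒳₁) ⊎ (Satisfiable 𝒳₂ × S₂ 𝒳₂)
  Disj S₁ S₂ 𝒳 = Σ[ 𝒳₁ ∈ Family ] Σ[ 𝒳₂ ∈ Family ] par 𝒳 𝒳₁ 𝒳₂ ×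
    (Satisfiable 𝒳₁ → S₁ 𝒳₁) × (Satisfiable 𝒳₂ → S₂ 𝒳₂)

  -- Where the semantics switches flag by dualising 𝒳, the clause for the other
  -- flag is inlined, which makes the recursion structural in the formula.
  -- The clauses are read for arbitrary families, since the parts of a partition
  -- may be empty, but Conj and Disj evaluate a subformula on nonempty parts only.
  Sat : Formula → Flag → Family → Set₁
  Sat (ltl ψ) ∃∀ 𝒳 =
    Lift (lsuc 0ℓ) (Σ[ X ∈ 2^Asg ] X ∈ 𝒳 × (∀ {χ} → χ ∈ ⟦ X ⟧ → χ ⊨LTL ψ))
  Sat (ltl ψ) ∀∃ 𝒳 =
    Lift (lsuc 0ℓ) (∀ {X} → X ∈ 𝒳 → Σ[ χ ∈ Asg ] χ ∈ ⟦ X ⟧ × χ ⊨LTL ψ)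
  Sat (¬′ φ)     α  𝒳 = ¬ Sat φ (dualFlag α) 𝒳
  Sat (φ₁ ∧′ φ₂) ∃∀ 𝒳 = Conj (Sat φ₁ ∃∀) (Sat φ₂ ∃∀) 𝒳
  Sat (φ₁ ∧′ φ₂) ∀∃ 𝒳 = Conj (Sat φ₁ ∃∀) (Sat φ₂ ∃∀) (dual 𝒳)
  Sat (φ₁ ∨′ φ₂) ∀∃ 𝒳 = Disj (Sat φ₁ ∀∃) (Sat φ₂ ∀∃) 𝒳
  Sat (φ₁ ∨′ φ₂) ∃∀ 𝒳 = Disj (Sat φ₁ ∀∃) (Sat φ₂ ∀∃) (dual 𝒳)
  Sat (∃′ p σ φ) ∃∀ 𝒳 = Sat φ ∃∀ (ext σ 𝒳 p)
  Sat (∃′ p σ φ) ∀∃ 𝒳 = Sat φ ∃∀ (ext σ (dual 𝒳) p)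
  Sat (∀′ p σ φ) ∀∃ 𝒳 = Sat φ ∀∃ (ext σ 𝒳 p)
  Sat (∀′ p σ φ) ∃∀ 𝒳 = Sat φ ∀∃ (ext σ (dual 𝒳) p)

  infix 4 _⊨[_]_
  _⊨[_]_ : Family → Flag → Formula → Set₁
  𝒳 ⊨[ α ] φ = Sat φ α 𝒳

{-# OPTIONS --safe #-}

-- Induction on φ, for both directions at once because negation exchanges the
-- flags.  Precomposing choice functions with a map f : 𝒳₁ → 𝒳₂ such that
-- f(X) ⊆ X shows that dualisation reverses ⊑.  Extending both sides by the same
-- functors preserves ⊑.  A partition (𝒜, ℬ) of 𝒳₂ pulls back to 𝒳₁: X goes to
-- the first part iff some member of 𝒜 is included in X.

module Submission where

open import Defs
open import Level using (0ℓ; lift)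
open import Data.Bool using (false)
open import Data.Empty using (⊥-elim)
open import Data.Irrelevant using ([_])
open import Data.Maybe.Relation.Unary.Any using (just)
open import Data.Product using (Σ-syntax; _×_; _,_; proj₁; proj₂)
open import Data.Refinement using (_,_; value)
open import Data.Sum using (inj₁; inj₂; map₁) renaming (map to map⊎)
open import Data.Unit using (tt)
open import Function using (_∘_)
open import Relation.Nullary using (yes; no; isYes; recompute)
open import Relation.Nullary.Decidable using (toWitness; fromWitness)
open import Relation.Unary
  using (Pred; _∈_; _⊆_; _≐_; _∪_; _∩_; _∖_; ｛_｝; Satisfiable)
open import Relation.Unary.Properties using (≐-sym; ≐-trans)
open import Relation.Binary.PropositionalEquality using (_≡_; refl)
open import Axiom.ExcludedMiddle using (ExcludedMiddle)

module _ (em : ExcludedMiddle 0ℓ) (AP : Set) where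
  open GFG-QPTL AP (λ _ _ → em)

  -- Excluded middle decides `P` at the element, and `recompute` uses the decision to turn the
  -- irrelevant membership proof into a relevant one.
  value∈ : {A : Set} {P : Pred A 0ℓ} (x : ⟨ P ⟩) → value x ∈ P
  value∈ (_ , [ x∈P ]) = recompute em x∈P

  ⟨⟩-map : {A : Set} {P Q : Pred A 0ℓ} → P ⊆ Q → ⟨ P ⟩ → ⟨ Q ⟩
  ⟨⟩-map P⊆Q (x , [ x∈P ]) = x , [ P⊆Q x∈P ]

  characteristic : Pred Asg 0ℓ → 2^Asg
  characteristic R χ = isYes (em {R χ})

  ⟦characteristic⟧ : (R : Pred Asg 0ℓ) → ⟦ characteristic R ⟧ ≐ R
  ⟦characteristic⟧ R = toWitness , fromWitness

  HAsg-resp-≐ : ∀ {P Q 𝒳} → P ≐ Q → HAsg[ P ] 𝒳 → HAsg[ Q ] 𝒳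
  HAsg-resp-≐ P≐Q h = record
    { nonempty = nonempty
    ; ∅∉       = ∅∉
    ; over     = λ X∈𝒳 χ∈X → ≐-trans (over X∈𝒳 χ∈X) P≐Q
    }
    where open HAsg[_] h

  HAsg-⊆ : ∀ {P 𝒳 𝒴} → HAsg[ P ] 𝒳 → 𝒴 ⊆ 𝒳 → Satisfiable 𝒴 → HAsg[ P ] 𝒴
  HAsg-⊆ h 𝒴⊆𝒳 s = record
    { nonempty = s ; ∅∉ = ∅∉ ∘ 𝒴⊆𝒳 ; over = over ∘ 𝒴⊆𝒳 }
    where open HAsg[_] h

  -- Any assignment in a member X₂ ⊆ X₁ belongs to both sides, so its domain is both `P` and `Q`.
  ⊑⇒≐ : ∀ {P Q 𝒳₁ 𝒳₂} → HAsg[ P ] 𝒳₁ → HAsg[ Q ] 𝒳₂ → 𝒳₁ ⊑ 𝒳₂ → P ≐ Q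
  ⊑⇒≐ h₁ h₂ 𝒳₁⊑𝒳₂ =
    let (_ , X₁∈𝒳₁)          = HAsg[_].nonempty h₁
        (_ , X₂∈𝒳₂ , X₂⊆X₁) = 𝒳₁⊑𝒳₂ X₁∈𝒳₁
        (_ , χ∈X₂)           = HAsg[_].∅∉ h₂ X₂∈𝒳₂
    in ≐-trans (≐-sym (HAsg[_].over h₁ X₁∈𝒳₁ (X₂⊆X₁ χ∈X₂)))
               (HAsg[_].over h₂ X₂∈𝒳₂ χ∈X₂)

  ⊑-satisfiable : ∀ {𝒳₁ 𝒳₂} → 𝒳₁ ⊑ 𝒳₂ → Satisfiable 𝒳₁ → Satisfiable 𝒳₂
  ⊑-satisfiable 𝒳₁⊑𝒳₂ (_ , X∈𝒳₁) =
    let (X₂ , X₂∈𝒳₂ , _) = 𝒳₁⊑𝒳₂ X∈𝒳₁ in X₂ , X₂∈𝒳₂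

  par-⊆ˡ : ∀ {𝒳 𝒜 ℬ} → par 𝒳 𝒜 ℬ → 𝒜 ⊆ 𝒳
  par-⊆ˡ (_ , ∪⊆ , _) = ∪⊆ ∘ inj₁

  par-⊆ʳ : ∀ {𝒳 𝒜 ℬ} → par 𝒳 𝒜 ℬ → ℬ ⊆ 𝒳
  par-⊆ʳ (_ , ∪⊆ , _) = ∪⊆ ∘ inj₂

  par-pullback : ∀ {𝒳₁ 𝒳₂ 𝒜₂ ℬ₂} → 𝒳₁ ⊑ 𝒳₂ → par 𝒳₂ 𝒜₂ ℬ₂ →
    Σ[ 𝒜₁ ∈ Family ] Σ[ ℬ₁ ∈ Family ]
      par 𝒳₁ 𝒜₁ ℬ₁ × 𝒜₁ ⊑ 𝒜₂ × ℬ₁ ⊑ ℬ₂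
  par-pullback {𝒳₁} {𝒳₂} {𝒜₂} {ℬ₂} 𝒳₁⊑𝒳₂ (_ , _ , ⊆∪) =
    𝒳₁ ∩ Above , 𝒳₁ ∖ Above
    , (disjoint , union , split)
    , proj₂
    , below
    where
    Above : Family
    Above X₁ = Σ[ X₂ ∈ 2^Asg ] X₂ ∈ 𝒜₂ × ⟦ X₂ ⟧ ⊆ ⟦ X₁ ⟧

    disjoint = (λ ((_ , above) , (_ , ¬above)) → ¬above above) , λ ()

    union : (𝒳₁ ∩ Above) ∪ (𝒳₁ ∖ Above) ⊆ 𝒳₁
    union (inj₁ (X∈𝒳₁ , _)) = X∈𝒳₁
    union (inj₂ (X∈𝒳₁ , _)) = X∈𝒳₁

    split : 𝒳₁ ⊆ (𝒳₁ ∩ Above) ∪ (𝒳₁ ∖ Above)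
    split {X} X∈𝒳₁ with em {Above X}
    ... | yes above = inj₁ (X∈𝒳₁ , above)
    ... | no ¬above = inj₂ (X∈𝒳₁ , ¬above)

    below : (𝒳₁ ∖ Above) ⊑ ℬ₂
    below (X∈𝒳₁ , ¬above) with 𝒳₁⊑𝒳₂ X∈𝒳₁
    ... | X₂ , X₂∈𝒳₂ , X₂⊆X₁ with ⊆∪ X₂∈𝒳₂
    -- Lying in `𝒜₂` would have put the set into the first part, so the member found below it must
    -- come from `ℬ₂`.
    ...   | inj₁ X₂∈𝒜₂ = ⊥-elim (¬above (X₂ , X₂∈𝒜₂ , X₂⊆X₁))
    ...   | inj₂ X₂∈ℬ₂ = X₂ , X₂∈ℬ₂ , X₂⊆X₁

  dual-antitone : ∀ {𝒳₁ 𝒳₂} → 𝒳₁ ⊑ 𝒳₂ → dual 𝒳₂ ⊑ dual 𝒳₁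
  dual-antitone {𝒳₁} {𝒳₂} 𝒳₁⊑𝒳₂ {Y₂} (c , c∈ , _ , img⊆Y₂) =
    characteristic (img c∘f) , (c∘f , c∘f∈ , ⟦characteristic⟧ _)
    , Y₁⊆Y₂ ∘ proj₁ (⟦characteristic⟧ (img c∘f))
    where
    f : ⟨ 𝒳₁ ⟩ → ⟨ 𝒳₂ ⟩
    -- The witness in `⊑` may depend on the membership proof; feeding it the recomputed one makes
    -- `f` depend on the element only.
    f X = let (X₂ , X₂∈𝒳₂ , _) = 𝒳₁⊑𝒳₂ (value∈ X) in X₂ , [ X₂∈𝒳₂ ]

    c∘f : ⟨ 𝒳₁ ⟩ → Asg
    c∘f = c ∘ f

    c∘f∈ : IsChoiceFunction 𝒳₁ c∘f
    c∘f∈ X = proj₂ (proj₂ (𝒳₁⊑𝒳₂ (value∈ X))) (c∈ (f X))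

    Y₁⊆Y₂ : img c∘f ⊆ ⟦ Y₂ ⟧
    Y₁⊆Y₂ (X , refl) = img⊆Y₂ (f X , refl)

  dual-HAsg : ∀ {P 𝒳} → HAsg[ P ] 𝒳 → HAsg[ P ] (dual 𝒳)
  dual-HAsg {P} {𝒳} h = record
    { nonempty = characteristic (img choice)
               , choice , (λ X → proj₂ (∅∉ (value∈ X))) , ⟦characteristic⟧ _
    ; ∅∉       = λ (c , _ , _ , img⊆Y) →
        let (X , X∈𝒳) = nonempty in c (X , [ X∈𝒳 ]) , img⊆Y (_ , refl)
    ; over     = λ {Y} (c , c∈ , Y⊆img , _) χ∈Y → img-over c c∈ (Y⊆img χ∈Y)
    }
    where
    open HAsg[_] h

    choice : ⟨ 𝒳 ⟩ → Asg
    choice X = proj₁ (∅∉ (value∈ X))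

    img-over : ∀ c → IsChoiceFunction 𝒳 c → img c ⊆ Asg[ P ]
    img-over c c∈ (X , refl) = over (value∈ X) (c∈ X)

  -- The domains `ap 𝒳₁` and `ap 𝒳₂` agree only extensionally, so a functor has to be transported
  -- from one to the other.
  Fnc-pullback : ∀ {P Q} → P ≐ Q → Fnc P → Fnc Q
  Fnc-pullback P≐Q F = F ∘ ⟨⟩-map (λ dom≐Q → ≐-trans dom≐Q (≐-sym P≐Q))

  Fnc-pullback-∈ : ∀ {P Q} σ (P≐Q : P ≐ Q) {F} →
    F ∈ Fnc[ σ ] P → Fnc-pullback P≐Q F ∈ Fnc[ σ ] Q
  Fnc-pullback-∈ σ (P⊆Q , Q⊆P) (b , s) =
      (λ (p∈B , p∈Q) k _ _ (off , on) →
        b (p∈B , Q⊆P p∈Q) k _ _ ((λ q∈P → off (P⊆Q q∈P)) , on))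
    , (λ (p∈S , p∈Q) k _ _ (off , on) →
        s (p∈S , Q⊆P p∈Q) k _ _ ((λ q∈P → off (P⊆Q q∈P)) , on))

  ext-monotone : ∀ {P 𝒳₁ 𝒳₂} σ p → HAsg[ P ] 𝒳₁ → HAsg[ P ] 𝒳₂ →
    𝒳₁ ⊑ 𝒳₂ → ext σ 𝒳₁ p ⊑ ext σ 𝒳₂ p
  ext-monotone {𝒳₁ = 𝒳₁} {𝒳₂} σ p h₁ h₂ 𝒳₁⊑𝒳₂ {Y₁}
    (X₁ , X₁∈𝒳₁ , F , F∈ , _ , ext⊆Y₁) =
    let (X₂ , X₂∈𝒳₂ , X₂⊆X₁) = 𝒳₁⊑𝒳₂ X₁∈𝒳₁
    in characteristic (extSet X₂ G p)
     , (X₂ , X₂∈𝒳₂ , G , Fnc-pullback-∈ σ ap≐ {F} F∈ , ⟦characteristic⟧ _)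
     , λ χ∈ → Y₂⊆Y₁ X₂⊆X₁ (proj₁ (⟦characteristic⟧ (extSet X₂ G p)) χ∈)
    where
    ap≐ : ap 𝒳₁ ≐ ap 𝒳₂
    ap≐ = ≐-trans (ap-unique h₁) (≐-sym (ap-unique h₂))

    G : Fnc (ap 𝒳₂)
    G = Fnc-pullback ap≐ F

    Y₂⊆Y₁ : ∀ {X₂} → ⟦ X₂ ⟧ ⊆ ⟦ X₁ ⟧ → extSet X₂ G p ⊆ ⟦ Y₁ ⟧
    -- The preimage is the same assignment with its domain proof transported; `G` is `F` after this
    -- transport, so the extensions coincide by computation.
    Y₂⊆Y₁ X₂⊆X₁ (_ , χ∈X₂ , refl) = ext⊆Y₁ (_ , X₂⊆X₁ χ∈X₂ , refl)

  dom-↦ : ∀ χ p f → dom (χ [ p ↦ f ]) ≐ (dom χ ∪ ｛ p ｝)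
  dom-↦ χ p f = to , from
    where
    to : dom (χ [ p ↦ f ]) ⊆ dom χ ∪ ｛ p ｝
    to {q} q∈ with em {q ≡ p}
    ... | yes refl = inj₂ refl
    ... | no _     = inj₁ q∈

    from : dom χ ∪ ｛ p ｝ ⊆ dom (χ [ p ↦ f ])
    from {q} q∈ with em {q ≡ p} | q∈
    ... | yes _  | _         = just tt
    ... | no _   | inj₁ q∈χ  = q∈χ
    ... | no q≢p | inj₂ refl = ⊥-elim (q≢p refl)

  ext-HAsg : ∀ {P 𝒳} σ p → HAsg[ P ] 𝒳 → HAsg[ P ∪ ｛ p ｝ ] (ext σ 𝒳 p)
  ext-HAsg {P} {𝒳} σ p h = record
    { nonempty =
        let (X , X∈𝒳) = nonempty
        -- A constant functor meets every behavioral constraint, so each `σ` admits at least one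
        -- extension.
        in characteristic (extSet X (λ _ _ → false) p)
         , X , X∈𝒳 , (λ _ _ → false)
         , ((λ _ _ _ _ _ → refl) , (λ _ _ _ _ _ → refl))
         , ⟦characteristic⟧ _
    ; ∅∉       = λ (X , X∈𝒳 , F , _ , _ , ext⊆Y) →
        let (χ , χ∈X) = ∅∉ X∈𝒳
        in _ , ext⊆Y ((χ , [ ≐-trans (over X∈𝒳 χ∈X) (≐-sym (ap-unique h)) ])
                     , χ∈X , refl)
    ; over     = λ (X , X∈𝒳 , F , _ , Y⊆ext , _) χ∈Y →
        ext-over X∈𝒳 F (Y⊆ext χ∈Y)
    }
    where
    open HAsg[_] h

    ext-over : ∀ {X} → X ∈ 𝒳 → ∀ F → extSet X F p ⊆ Asg[ P ∪ ｛ p ｝ ]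
    ext-over X∈𝒳 F (χ , χ∈X , refl) =
      let (dom⊆P , P⊆dom) = over X∈𝒳 χ∈X
      in ≐-trans (dom-↦ (value χ) p (F χ)) (map₁ dom⊆P , map₁ P⊆dom)

  -- One `P` serves both families so that functors can be exchanged; it is quantified inside because
  -- extension enlarges it.
  Monotone Antitone : (Family → Set₁) → Set₁
  Monotone S = ∀ {P 𝒳₁ 𝒳₂} →
    HAsg[ P ] 𝒳₁ → HAsg[ P ] 𝒳₂ → 𝒳₁ ⊑ 𝒳₂ → S 𝒳₁ → S 𝒳₂
  Antitone S = ∀ {P 𝒳₁ 𝒳₂} →
    HAsg[ P ] 𝒳₁ → HAsg[ P ] 𝒳₂ → 𝒳₁ ⊑ 𝒳₂ → S 𝒳₂ → S 𝒳₁

  -- The hypothesis, applied to the pulled-back partition, selects a nonempty part. Nonemptiness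
  -- passes up along `⊑`, so the two corresponding parts are hyperassignments and can be compared.
  Conj-monotone : ∀ {S₁ S₂} → Monotone S₁ → Monotone S₂ → Monotone (Conj S₁ S₂)
  Conj-monotone m₁ m₂ h₁ h₂ 𝒳₁⊑𝒳₂ s 𝒜₂ ℬ₂ par₂ =
    let (𝒜₁ , ℬ₁ , par₁ , 𝒜₁⊑𝒜₂ , ℬ₁⊑ℬ₂) = par-pullback 𝒳₁⊑𝒳₂ par₂
    in map⊎
      (λ (ne₁ , s₁) → let ne₂ = ⊑-satisfiable 𝒜₁⊑𝒜₂ ne₁ in
        ne₂ , m₁ (HAsg-⊆ h₁ (par-⊆ˡ par₁) ne₁) (HAsg-⊆ h₂ (par-⊆ˡ par₂) ne₂) 𝒜₁⊑𝒜₂ s₁)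
      (λ (ne₁ , s₁) → let ne₂ = ⊑-satisfiable ℬ₁⊑ℬ₂ ne₁ in
        ne₂ , m₂ (HAsg-⊆ h₁ (par-⊆ʳ par₁) ne₁) (HAsg-⊆ h₂ (par-⊆ʳ par₂) ne₂) ℬ₁⊑ℬ₂ s₁)
      (s 𝒜₁ ℬ₁ par₁)

  -- The pullback of the given partition of `𝒳₂` is the required partition of `𝒳₁`.
  Disj-antitone : ∀ {S₁ S₂} → Antitone S₁ → Antitone S₂ → Antitone (Disj S₁ S₂)
  Disj-antitone a₁ a₂ h₁ h₂ 𝒳₁⊑𝒳₂ (𝒜₂ , ℬ₂ , par₂ , s₁ , s₂) =
    let (𝒜₁ , ℬ₁ , par₁ , 𝒜₁⊑𝒜₂ , ℬ₁⊑ℬ₂) = par-pullback 𝒳₁⊑𝒳₂ par₂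
    in 𝒜₁ , ℬ₁ , par₁
     , (λ ne₁ → let ne₂ = ⊑-satisfiable 𝒜₁⊑𝒜₂ ne₁ in
         a₁ (HAsg-⊆ h₁ (par-⊆ˡ par₁) ne₁) (HAsg-⊆ h₂ (par-⊆ˡ par₂) ne₂) 𝒜₁⊑𝒜₂ (s₁ ne₂))
     , (λ ne₁ → let ne₂ = ⊑-satisfiable ℬ₁⊑ℬ₂ ne₁ in
         a₂ (HAsg-⊆ h₁ (par-⊆ʳ par₁) ne₁) (HAsg-⊆ h₂ (par-⊆ʳ par₂) ne₂) ℬ₁⊑ℬ₂ (s₂ ne₂))

  -- Dualisation reverses `⊑`, so variance flips exactly where the semantics switches flag.
  dual-Monotone : ∀ {S} → Monotone S → Antitone (S ∘ dual)
  dual-Monotone m h₁ h₂ 𝒳₁⊑𝒳₂ =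
    m (dual-HAsg h₂) (dual-HAsg h₁) (dual-antitone 𝒳₁⊑𝒳₂)

  dual-Antitone : ∀ {S} → Antitone S → Monotone (S ∘ dual)
  dual-Antitone a h₁ h₂ 𝒳₁⊑𝒳₂ =
    a (dual-HAsg h₂) (dual-HAsg h₁) (dual-antitone 𝒳₁⊑𝒳₂)

  ext-Monotone : ∀ {S} σ p → Monotone S → Monotone (λ 𝒳 → S (ext σ 𝒳 p))
  ext-Monotone σ p m h₁ h₂ 𝒳₁⊑𝒳₂ =
    m (ext-HAsg σ p h₁) (ext-HAsg σ p h₂) (ext-monotone σ p h₁ h₂ 𝒳₁⊑𝒳₂)

  ext-Antitone : ∀ {S} σ p → Antitone S → Antitone (λ 𝒳 → S (ext σ 𝒳 p))
  ext-Antitone σ p a h₁ h₂ 𝒳₁⊑𝒳₂ =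
    a (ext-HAsg σ p h₁) (ext-HAsg σ p h₂) (ext-monotone σ p h₁ h₂ 𝒳₁⊑𝒳₂)

  Sat-monotone : ∀ φ → Monotone (Sat φ ∃∀)
  Sat-antitone : ∀ φ → Antitone (Sat φ ∀∃)

  Sat-monotone (ltl ψ) _ _ 𝒳₁⊑𝒳₂ (lift (_ , X₁∈𝒳₁ , s)) =
    let (X₂ , X₂∈𝒳₂ , X₂⊆X₁) = 𝒳₁⊑𝒳₂ X₁∈𝒳₁
    in lift (X₂ , X₂∈𝒳₂ , λ χ∈X₂ → s (X₂⊆X₁ χ∈X₂))
  Sat-monotone (¬′ φ) h₁ h₂ 𝒳₁⊑𝒳₂ ¬s s = ¬s (Sat-antitone φ h₁ h₂ 𝒳₁⊑𝒳₂ s)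
  Sat-monotone (φ₁ ∧′ φ₂) = Conj-monotone (Sat-monotone φ₁) (Sat-monotone φ₂)
  Sat-monotone (φ₁ ∨′ φ₂) =
    dual-Antitone (Disj-antitone (Sat-antitone φ₁) (Sat-antitone φ₂))
  Sat-monotone (∃′ p σ φ) = ext-Monotone σ p (Sat-monotone φ)
  Sat-monotone (∀′ p σ φ) = dual-Antitone (ext-Antitone σ p (Sat-antitone φ))

  Sat-antitone (ltl ψ) _ _ 𝒳₁⊑𝒳₂ (lift s) = lift λ X₁∈𝒳₁ →
    let (_ , X₂∈𝒳₂ , X₂⊆X₁) = 𝒳₁⊑𝒳₂ X₁∈𝒳₁
        (χ , χ∈X₂ , χ⊨ψ)     = s X₂∈𝒳₂
    in χ , X₂⊆X₁ χ∈X₂ , χ⊨ψ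
  Sat-antitone (¬′ φ) h₁ h₂ 𝒳₁⊑𝒳₂ ¬s s = ¬s (Sat-monotone φ h₁ h₂ 𝒳₁⊑𝒳₂ s)
  Sat-antitone (φ₁ ∧′ φ₂) =
    dual-Monotone (Conj-monotone (Sat-monotone φ₁) (Sat-monotone φ₂))
  Sat-antitone (φ₁ ∨′ φ₂) = Disj-antitone (Sat-antitone φ₁) (Sat-antitone φ₂)
  Sat-antitone (∃′ p σ φ) = dual-Monotone (ext-Monotone σ p (Sat-monotone φ))
  Sat-antitone (∀′ p σ φ) = ext-Antitone σ p (Sat-antitone φ)

mainTheorem8 : (em : ExcludedMiddle 0ℓ) (AP : Set) →
    let open GFG-QPTL AP (λ _ _ → em) in
    (φ : Formula) (𝒳₁ 𝒳₂ : Family) →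
    HAsg⊇[ free φ ] 𝒳₁ → HAsg⊇[ free φ ] 𝒳₂ → 𝒳₁ ⊑ 𝒳₂ →
    (𝒳₁ ⊨[ ∃∀ ] φ → 𝒳₂ ⊨[ ∃∀ ] φ) × (𝒳₂ ⊨[ ∀∃ ] φ → 𝒳₁ ⊨[ ∀∃ ] φ)
mainTheorem8 em AP φ 𝒳₁ 𝒳₂ ((_ , h₁) , _) ((_ , h₂) , _) 𝒳₁⊑𝒳₂ =
    Sat-monotone em AP φ h₁′ h₂ 𝒳₁⊑𝒳₂
  , Sat-antitone em AP φ h₁′ h₂ 𝒳₁⊑𝒳₂
  -- Each family comes with its own domain; here the first is restated over that of the second.
  where h₁′ = HAsg-resp-≐ em AP (⊑⇒≐ em AP h₁ h₂ 𝒳₁⊑𝒳₂) h₁
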